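{- Fix integers $n>1$ and $e\ge n-1$, and let $p$ be a prime. For each positive integer $t$, set $k = e - t(n-1)$, $c = \lceil e/t\rceil - (n-1)$ and $b = \lfloor e/t\rfloor - (n-1)$ (all depending on $t$). Set $$h(e,n) = \max_{\left\lceil\frac{e}{2(n-1)}\right\rceil \le t \le \left\lfloor\frac{e}{n-1}\right\rfloor} \left(k(n-1) - c^2(k+t-ct) - b^2(ct-k)\right),$$ where the maximum is over all integers $t$ in the indicated range. Then $$f_n(p^{e}) \ge p^{h(e,n)}.$$
   Context: A subring of $\mathbb{Z}^n$ is a sublattice (additive subgroup) of $\mathbb{Z}^n$ that contains the multiplicative identity $(1,1,\ldots,1)$ and is closed under componentwise multiplication. For a positive integer $m$, $f_n(m)$ denotes the number of subrings of $\mathbb{Z}^n$ of finite index $m$. -}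

module Defs where

open import Algebra.Bundles using (Ring)
import Algebra.Construct.Pointwise as Pointwise
import Algebra.Properties.AbelianGroup as AbelianGroupProperties
open import Data.Fin.Base as Fin using (Fin; toℕ; fromℕ<; finToFun; funToFin)
import Data.Fin.Properties as Fin
open import Data.Integer.Base as ℤ using (ℤ; +_; -[1+_]; 0ℤ; 1ℤ)
import Data.Integer.DivMod as ℤ
import Data.Integer.Divisibility.Signed as ℤ∣
import Data.Integer.Properties as ℤ
open import Data.Integer.Tactic.RingSolver using (solve-∀)
open import Data.List.Base as List using (List; filter; upTo; allFin; lookup)
import Data.List.Extrema ℤ.≤-totalOrder as Extrema
open import Data.List.Membership.Propositional using (_∈_)
open import Data.List.Membership.Propositional.Properties
  using (∈-filter⁺; ∈-filter⁻; ∈-allFin; ∈-lookup; ∈-map⁺; ∈-map⁻; ∈-upTo⁺; ∈-upTo⁻)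
import Data.List.Relation.Unary.All as All
import Data.List.Relation.Unary.Any as Any
import Data.List.Relation.Unary.Any.Properties as Any
open import Data.List.Relation.Unary.Unique.Propositional using (Unique; _∷_)
import Data.List.Relation.Unary.Unique.Propositional.Properties as Unique
open import Data.Nat.Base as ℕ using (ℕ; zero; suc; NonZero; _∸_; _!)
import Data.Nat.Divisibility as ℕ∣
open import Data.Nat.DivMod using (_/_; m≥n⇒m/n>0; m<n*o⇒m/o<n; _%_; m%n<n; m≡m%n+[m/n]*n)
import Data.Nat.Properties as ℕ
open import Data.Product using (Σ-syntax; ∃; ∃-syntax; _×_; _,_; proj₁; proj₂)
open import Data.Rational.Unnormalised.Base as ℚᵘ using (ℚᵘ)
open import Data.Sum.Base using (inj₁; inj₂)
open import Function.Base using (_∘_)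
open import Function.Bundles using (Inverse)
open import Level using (Level; 0ℓ; _⊔_)
open import Relation.Binary.Bundles using (Setoid)
open import Relation.Binary.PropositionalEquality as ≡
  using (_≡_; refl; sym; trans; cong; cong₂; subst)
open import Relation.Nullary using (Dec; yes; no; contradiction)
open import Relation.Nullary.Decidable using (map′; _×-dec_; _→-dec_)
open import Relation.Binary.Definitions using (_Respects_)
open import Relation.Unary using (Pred; _≐_; Decidable)
open import Relation.Unary.Properties using (≐-refl; ≐-sym; ≐-trans)

record Subring {c ℓ} (R : Ring c ℓ) (s : Level) : Set (c ⊔ ℓ ⊔ Level.suc s) where
  open Ring R
  field
    Member   : Pred Carrier s
    resp     : ∀ {x y} → x ≈ y → Member x → Member y
    0#-mem   : Member 0#
    +-closed : ∀ {x y} → Member x → Member y → Member (x + y)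
    -‿closed : ∀ {x} → Member x → Member (- x)
    1#-mem   : Member 1#
    *-closed : ∀ {x y} → Member x → Member y → Member (x * y)

open Subring public using (Member)

-- The additive quotient R / S.
cosets : ∀ {c ℓ s} {R : Ring c ℓ} → Subring R s → Setoid c s
cosets {R = R} S = record
  { Carrier       = Carrier
  ; _≈_           = λ x y → S.Member (x - y)
  ; isEquivalence = record
    { refl  = λ {x} → S.resp (R.sym (-‿inverseʳ x)) S.0#-mem
    ; sym   = λ {x} {y} p → S.resp (⁻¹-anti-homo‿- x y) (S.-‿closed p)
    ; trans = λ {x} {y} {z} p q → S.resp (telescope x y z) (S.+-closed p q)
    }
  }
  where
  module R = Ring R
  open R hiding (refl; sym; trans)
  module S = Subring S
  open AbelianGroupProperties +-abelianGroup using (⁻¹-anti-homo‿-)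
  telescope : ∀ x y z → (x - y) + (y - z) ≈ x - z
  telescope x y z = R.trans (+-assoc x (- y) (y - z)) (+-congˡ
    (R.trans (R.sym (+-assoc (- y) y (- z)))
      (R.trans (+-congʳ (-‿inverseˡ y)) (+-identityˡ (- z)))))

HasIndex : ∀ {c ℓ s} {R : Ring c ℓ} → Subring R s → ℕ → Set (c ⊔ s)
HasIndex S m = Inverse (cosets S) (≡.setoid (Fin m))

ℤ^_ : ℕ → Ring 0ℓ 0ℓ
ℤ^ n = Pointwise.ring (Fin n) ℤ.+-*-ring

-- Subrings are compared by their elements alone.  Membership in a subring of
-- finite index is decidable, so Set-valued predicates already give all of them.
subringsOfIndex : (n m : ℕ) → Setoid (Level.suc 0ℓ) 0ℓ
subringsOfIndex n m = record
  { Carrier       = Σ[ S ∈ Subring (ℤ^ n) 0ℓ ] HasIndex S m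
  ; _≈_           = λ S T → Member (proj₁ S) ≐ Member (proj₁ T)
  ; isEquivalence = record { refl = ≐-refl ; sym = ≐-sym ; trans = ≐-trans }
  }

------------------------------------------------------------------------
-- There are finitely many subrings of each index.  A subring S of index m
-- contains m! ℤⁿ, hence is determined by which points of the box
-- {0, …, m! - 1}ⁿ it contains, and the subsets of the box arising in this way
-- can be recognised by a finite search.

private
  -- A setoid that embeds in Fin K with decidable image is finite.
  module FiniteImage {a ℓ} (A : Setoid a ℓ) {K : ℕ}
    (code : Setoid.Carrier A → Fin K)
    (code-cong : ∀ {x y} → Setoid._≈_ A x y → code x ≡ code y)
    (code-injective : ∀ {x y} → code x ≡ code y → Setoid._≈_ A x y)
    (inImage? : ∀ k → Dec (∃[ x ] code x ≡ k))
    where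

    image : List (Fin K)
    image = filter inImage? (allFin K)

    image-unique : Unique image
    image-unique = Unique.filter⁺ inImage? (Unique.allFin⁺ K)

    lookup-injective : ∀ {b} {B : Set b} {xs : List B} → Unique xs →
                       ∀ i j → lookup xs i ≡ lookup xs j → i ≡ j
    lookup-injective (x∉ ∷ u) Fin.zero    Fin.zero    eq = refl
    lookup-injective (x∉ ∷ u) Fin.zero    (Fin.suc j) eq =
      contradiction eq (All.lookup x∉ (∈-lookup j))
    lookup-injective (x∉ ∷ u) (Fin.suc i) Fin.zero    eq =
      contradiction (sym eq) (All.lookup x∉ (∈-lookup i))
    lookup-injective (x∉ ∷ u) (Fin.suc i) (Fin.suc j) eq =
      cong Fin.suc (lookup-injective u i j eq)

    mem : ∀ x → code x ∈ image
    mem x = ∈-filter⁺ inImage? (∈-allFin (code x)) (x , refl)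

    index : Setoid.Carrier A → Fin (List.length image)
    index x = Any.index (mem x)

    lookup-index : ∀ x → lookup image (index x) ≡ code x
    lookup-index x = sym (Any.lookup-index (mem x))

    preimage : ∀ i → ∃[ x ] code x ≡ lookup image i
    preimage i = proj₂ (∈-filter⁻ inImage? {xs = allFin K} (∈-lookup i))

    finite : ∃[ N ] Inverse A (≡.setoid (Fin N))
    finite = List.length image , record
      { to        = index
      ; from      = proj₁ ∘ preimage
      ; to-cong   = λ {x} {y} x≈y → lookup-injective image-unique _ _
          (trans (lookup-index x) (trans (code-cong x≈y) (sym (lookup-index y))))
      ; from-cong = λ { refl → Setoid.refl A }
      ; inverse   =
          (λ {i} {x} x≈ → lookup-injective image-unique _ _
            (trans (lookup-index x) (trans (code-cong x≈) (proj₂ (preimage i)))))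
        , (λ {x} {i} eq → code-injective
            (trans (proj₂ (preimage i)) (trans (cong (lookup image) eq) (lookup-index x))))
      }

  module Enumeration (n m : ℕ) where
    module Zⁿ = Ring (ℤ^ n)
    open Zⁿ using () renaming (Carrier to Pt; _+_ to _⊕_; _*_ to _⊛_; -_ to ⊖_; _-_ to _⊝_; 0# to 𝟎; 1# to 𝟏)

    M : ℕ
    M = m !

    instance
      M≢0 : NonZero M
      M≢0 = m ℕ.!≢0

    infix 4 _≋_
    record _≋_ (x y : Pt) : Set where
      constructor mk≋
      field div : ∀ i → + M ℤ∣.∣ x i ℤ.- y i
    open _≋_

    ≋-via : ∀ {x y : Pt} (q : Fin n → ℤ) → (∀ i → x i ℤ.- y i ≡ q i ℤ.* + M) → x ≋ y
    ≋-via q eq = mk≋ λ i → ℤ∣.divides (q i) (eq i)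

    quot : ∀ {x y} → x ≋ y → Pt
    quot x≋y i = ℤ∣._∣_.quotient (div x≋y i)

    quot-eq : ∀ {x y} (p : x ≋ y) i → x i ℤ.- y i ≡ quot p i ℤ.* + M
    quot-eq p i = ℤ∣._∣_.equality (div p i)

    ≋-reflexive : ∀ {x y} → (∀ i → x i ≡ y i) → x ≋ y
    ≋-reflexive {x} {y} x≈y = ≋-via (λ _ → 0ℤ) λ i →
      trans (cong (λ v → v ℤ.- y i) (x≈y i)) (ℤ.+-inverseʳ (y i))

    ≋-refl : ∀ {x} → x ≋ x
    ≋-refl = ≋-reflexive λ _ → refl

    ≋-sym : ∀ {x y} → x ≋ y → y ≋ x
    ≋-sym {x} {y} p = mk≋ λ i →
      subst (+ M ℤ∣.∣_) (eq (x i) (y i)) (ℤ∣.∣m⇒∣-m (div p i))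
      where
      eq : ∀ a b → ℤ.- (a ℤ.- b) ≡ b ℤ.- a
      eq = solve-∀

    ≋-trans : ∀ {x y z} → x ≋ y → y ≋ z → x ≋ z
    ≋-trans {x} {y} {z} p q = mk≋ λ i →
      subst (+ M ℤ∣.∣_) (eq (x i) (y i) (z i)) (ℤ∣.∣m∣n⇒∣m+n (div p i) (div q i))
      where
      eq : ∀ a b c → (a ℤ.- b) ℤ.+ (b ℤ.- c) ≡ a ℤ.- c
      eq = solve-∀

    ⊕-cong : ∀ {x y z w} → x ≋ y → z ≋ w → x ⊕ z ≋ y ⊕ w
    ⊕-cong {x} {y} {z} {w} p q = mk≋ λ i →
      subst (+ M ℤ∣.∣_) (eq (x i) (y i) (z i) (w i)) (ℤ∣.∣m∣n⇒∣m+n (div p i) (div q i))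
      where
      eq : ∀ a b c d → (a ℤ.- b) ℤ.+ (c ℤ.- d) ≡ (a ℤ.+ c) ℤ.- (b ℤ.+ d)
      eq = solve-∀

    ⊖-cong : ∀ {x y} → x ≋ y → ⊖ x ≋ ⊖ y
    ⊖-cong {x} {y} p = mk≋ λ i →
      subst (+ M ℤ∣.∣_) (eq (x i) (y i)) (ℤ∣.∣m⇒∣-m (div p i))
      where
      eq : ∀ a b → ℤ.- (a ℤ.- b) ≡ (ℤ.- a) ℤ.- (ℤ.- b)
      eq = solve-∀

    ⊛-cong : ∀ {x y z w} → x ≋ y → z ≋ w → x ⊛ z ≋ y ⊛ w
    ⊛-cong {x} {y} {z} {w} p q = mk≋ λ i →
      subst (+ M ℤ∣.∣_) (eq (x i) (y i) (z i) (w i))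
        (ℤ∣.∣m∣n⇒∣m+n (ℤ∣.∣m⇒∣m*n (z i) (div p i)) (ℤ∣.∣n⇒∣m*n (y i) (div q i)))
      where
      eq : ∀ a b c d → (a ℤ.- b) ℤ.* c ℤ.+ b ℤ.* (c ℤ.- d) ≡ a ℤ.* c ℤ.- b ℤ.* d
      eq = solve-∀

    _≋?_ : ∀ x y → Dec (x ≋ y)
    x ≋? y = map′ mk≋ div (Fin.all? λ i → + M ℤ∣.∣? (x i ℤ.- y i))

    -- Finite search modulo M.

    B : ℕ
    B = M ℕ.^ n

    pt : Fin B → Pt
    pt b i = + toℕ (finToFun {M} {n} b i)

    red : Pt → Fin B
    red x = funToFin (λ i → fromℕ< (ℤ.n%ℕd<d (x i) M))

    red-≋ : ∀ x → x ≋ pt (red x)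
    red-≋ x = ≋-via (λ i → x i ℤ./ℕ M) λ i → begin
      x i ℤ.- pt (red x) i
        ≡⟨ cong (λ v → x i ℤ.- + v) (trans (cong toℕ (Fin.finToFun-funToFin {n} {M} _ i)) (Fin.toℕ-fromℕ< _)) ⟩
      x i ℤ.- + (x i ℤ.%ℕ M)
        ≡⟨ cong (λ v → v ℤ.- + (x i ℤ.%ℕ M)) (ℤ.a≡a%ℕn+[a/ℕn]*n (x i) M) ⟩
      + (x i ℤ.%ℕ M) ℤ.+ (x i ℤ./ℕ M) ℤ.* + M ℤ.- + (x i ℤ.%ℕ M)
        ≡⟨ eq (+ (x i ℤ.%ℕ M)) ((x i ℤ./ℕ M) ℤ.* + M) ⟩
      (x i ℤ./ℕ M) ℤ.* + M ∎
      where
      open ≡.≡-Reasoning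
      eq : ∀ a b → a ℤ.+ b ℤ.- a ≡ b
      eq = solve-∀

    ∀dec : ∀ {q} {Q : Pred Pt q} → Q Respects _≋_ → Decidable Q → Dec (∀ x → Q x)
    ∀dec resp Q? = map′ (λ h x → resp (≋-sym (red-≋ x)) (h (red x))) (λ h b → h (pt b))
                        (Fin.all? (Q? ∘ pt))

    ∃dec : ∀ {k q} {Q : Pred (Fin k → Pt) q} →
           (∀ {r s} → (∀ i → r i ≋ s i) → Q r → Q s) → Decidable Q → Dec (∃ Q)
    ∃dec {k} resp Q? = map′ (λ (b , q) → (pt ∘ finToFun b) , q)
      (λ (r , q) → funToFin (red ∘ r) ,
        resp (λ i → subst (λ b → r i ≋ pt b) (sym (Fin.finToFun-funToFin (red ∘ r) i)) (red-≋ (r i))) q)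
      (Fin.any? λ b → Q? (pt ∘ finToFun {B} {k} b))

    -- Closed P says that P is a subring with m cosets, represented by reps.

    record Transversal (P : Pred Pt 0ℓ) (r : Fin m → Pt) : Set where
      field
        distinct : ∀ i j → P (r i ⊝ r j) → i ≡ j
        covers   : ∀ x → ∃[ i ] P (x ⊝ r i)

    record Closed (P : Pred Pt 0ℓ) : Set where
      field
        zero∈ : P 𝟎
        one∈  : P 𝟏
        sum∈  : ∀ x y → P x → P y → P (x ⊕ y)
        neg∈  : ∀ x → P x → P (⊖ x)
        mul∈  : ∀ x y → P x → P y → P (x ⊛ y)
        reps  : ∃ (Transversal P)

    module _ {P : Pred Pt 0ℓ} (resp : P Respects _≋_) (P? : Decidable P) where

      transversal? : Decidable (Transversal P)
      transversal? r = map′ (λ (d , c) → record { distinct = d ; covers = c })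
                            (λ t → Transversal.distinct t , Transversal.covers t)
        ((Fin.all? λ i → Fin.all? λ j → P? (r i ⊝ r j) →-dec (i Fin.≟ j))
         ×-dec ∀dec (λ x≋y (i , p) → i , resp (⊕-cong x≋y ≋-refl) p)
                    (λ x → Fin.any? λ i → P? (x ⊝ r i)))

      closed? : Dec (Closed P)
      closed? = map′
        (λ (a , b , c , d , e , f) → record
          { zero∈ = a ; one∈ = b ; sum∈ = c ; neg∈ = d ; mul∈ = e ; reps = f })
        (λ c → let open Closed c in zero∈ , one∈ , sum∈ , neg∈ , mul∈ , reps)
        (P? 𝟎 ×-dec P? 𝟏
         ×-dec ∀dec (λ x≋x′ h y p q → resp (⊕-cong x≋x′ ≋-refl) (h y (resp (≋-sym x≋x′) p) q))
                 (λ x → ∀dec (λ y≋y′ h p q → resp (⊕-cong (≋-refl {x}) y≋y′) (h p (resp (≋-sym y≋y′) q)))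
                   (λ y → P? x →-dec (P? y →-dec P? (x ⊕ y))))
         ×-dec ∀dec (λ x≋x′ h p → resp (⊖-cong x≋x′) (h (resp (≋-sym x≋x′) p)))
                 (λ x → P? x →-dec P? (⊖ x))
         ×-dec ∀dec (λ x≋x′ h y p q → resp (⊛-cong x≋x′ ≋-refl) (h y (resp (≋-sym x≋x′) p) q))
                 (λ x → ∀dec (λ y≋y′ h p q → resp (⊛-cong (≋-refl {x}) y≋y′) (h p (resp (≋-sym y≋y′) q)))
                   (λ y → P? x →-dec (P? y →-dec P? (x ⊛ y))))
         ×-dec ∃dec (λ r≋s t → record
                   { distinct = λ i j p → Transversal.distinct t i j
                       (resp (⊕-cong (≋-sym (r≋s i)) (⊖-cong (≋-sym (r≋s j)))) p)
                   ; covers = λ x → let (i , p) = Transversal.covers t x in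
                       i , resp (⊕-cong (≋-refl {x}) (⊖-cong (r≋s i))) p })
                 transversal?)

      toSubring : Closed P → Subring (ℤ^ n) 0ℓ
      toSubring c = record
        { Member   = P
        ; resp     = λ x≈y → resp (≋-reflexive x≈y)
        ; 0#-mem   = zero∈
        ; +-closed = λ {x} {y} → sum∈ x y
        ; -‿closed = λ {x} → neg∈ x
        ; 1#-mem   = one∈
        ; *-closed = λ {x} {y} → mul∈ x y
        }
        where open Closed c

      toIndexed : Closed P → Setoid.Carrier (subringsOfIndex n m)
      toIndexed c = toSubring c , record
        { to        = λ x → proj₁ (covers x)
        ; from      = r
        ; to-cong   = λ {x} {y} x~y → to-unique {x} {y} (proj₂ (covers x)) x~y (proj₂ (covers y))
        ; from-cong = λ { {i} refl → ~.refl {r i} }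
        ; inverse   = (λ {i} {x} x~ri → distinct _ _
                        (~.trans {r (proj₁ (covers x))} {x} {r i}
                          (~.sym {x} {r (proj₁ (covers x))} (proj₂ (covers x))) x~ri))
                    , (λ { {x} refl → ~.sym {x} {r (proj₁ (covers x))} (proj₂ (covers x)) })
        }
        where
        module ~ = Setoid (cosets (toSubring c))
        r = proj₁ (Closed.reps c)
        open Transversal (proj₂ (Closed.reps c))
        to-unique : ∀ {x y i j} → P (x ⊝ r i) → P (x ⊝ y) → P (y ⊝ r j) → i ≡ j
        to-unique {x} {y} {i} {j} p q s = distinct i j
          (~.trans {r i} {x} {r j} (~.sym {x} {r i} p) (~.trans {x} {y} {r j} q s))

    -- Membership in a subring of index m is decidable and periodic modulo M.

    module Given (S : Subring (ℤ^ n) 0ℓ) (ix : HasIndex S m) where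
      open Subring S renaming (Member to In-S)
      module ix = Inverse ix
      module ~ = Setoid (cosets S)

      same : ∀ {x y} → ix.to x ≡ ix.to y → In-S (x ⊝ y)
      same {x} {y} eq = ~.trans {x} {ix.from (ix.to x)} {y}
        (~.sym {ix.from (ix.to x)} {x} (ix.inverseʳ refl)) (ix.inverseʳ eq)

      x-0 : ∀ x → (x ⊝ 𝟎) Zⁿ.≈ x
      x-0 x i = ℤ.+-identityʳ (x i)

      Member? : Decidable In-S
      Member? x = map′ (λ eq → resp (x-0 x) (same eq))
                       (λ p → ix.to-cong (resp {x} {x ⊝ 𝟎} (λ i → sym (x-0 x i)) p))
                       (ix.to x Fin.≟ ix.to 𝟎)

      infixr 7 _•_
      _•_ : ℕ → Pt → Pt
      (k • x) i = + k ℤ.* x i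

      •-mem : ∀ k {x} → In-S x → In-S (k • x)
      •-mem zero    p = 0#-mem
      •-mem (suc k) {x} p = resp (λ i → eq (x i)) (+-closed p (•-mem k p))
        where
        eq : ∀ a → a ℤ.+ + k ℤ.* a ≡ + suc k ℤ.* a
        eq a = sym (ℤ.suc-* (+ k) a)

      M•-mem : ∀ z → In-S (M • z)
      M•-mem z with Fin.pigeonhole (ℕ.n<1+n m) (λ i → ix.to (toℕ i • z))
      ... | i , j , i<j , eq = resp step (•-mem (ℕ∣.quotient d∣M) d•z)
        where
        d : ℕ
        d = toℕ j ∸ toℕ i
        d•z : In-S (d • z)
        d•z = resp (λ k → trans (lem (+ toℕ j) (+ toℕ i) (z k))
                    (cong (ℤ._* z k) (trans (ℤ.m-n≡m⊖n (toℕ j) (toℕ i)) (ℤ.⊖-≥ (ℕ.<⇒≤ i<j)))))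
                   (same {toℕ j • z} {toℕ i • z} (sym eq))
          where
          lem : ∀ a b c → a ℤ.* c ℤ.- b ℤ.* c ≡ (a ℤ.- b) ℤ.* c
          lem = solve-∀
        d≤m : d ℕ.≤ m
        d≤m = ℕ.≤-trans (ℕ.m∸n≤m (toℕ j) (toℕ i)) (ℕ.<⇒≤pred (Fin.toℕ<n j))
        ∣! : ∀ k → 0 ℕ.< k → k ℕ∣.∣ k !
        ∣! (suc k) _ = ℕ∣.m∣m*n (k !)
        d∣M : d ℕ∣.∣ M
        d∣M = ℕ∣.∣-trans (∣! d (ℕ.m<n⇒0<n∸m i<j)) (ℕ∣.m≤n⇒m!∣n! d≤m)
        step : (ℕ∣.quotient d∣M • d • z) Zⁿ.≈ (M • z)
        step k = trans (sym (ℤ.*-assoc (+ ℕ∣.quotient d∣M) (+ d) (z k)))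
          (cong (ℤ._* z k) (trans (sym (ℤ.pos-* (ℕ∣.quotient d∣M) d))
            (cong +_ (sym (ℕ∣._∣_.equality d∣M)))))

      Member-resp : In-S Respects _≋_
      Member-resp {x} {y} p mx =
        resp (λ i → trans (cong (λ v → x i ℤ.- v) (trans (ℤ.*-comm (+ M) (quot p i)) (sym (quot-eq p i))))
                          (lem (x i) (y i)))
             (+-closed mx (-‿closed (M•-mem (quot p))))
        where
        lem : ∀ a b → a ℤ.- (a ℤ.- b) ≡ b
        lem = solve-∀

      closed : Closed In-S
      closed = record
        { zero∈ = 0#-mem
        ; one∈  = 1#-mem
        ; sum∈  = λ _ _ → +-closed
        ; neg∈  = λ _ → -‿closed
        ; mul∈  = λ _ _ → *-closed
        ; reps  = ix.from , record
          { distinct = λ i j p → trans (sym (ix.strictlyInverseˡ i)) (trans (ix.to-cong p) (ix.strictlyInverseˡ j))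
          ; covers   = λ x → ix.to x , ~.sym {ix.from (ix.to x)} {x} (ix.inverseʳ refl)
          }
        }

    -- Subsets of the box, as characteristic functions.

    Code : ℕ
    Code = 2 ℕ.^ B

    In : Fin Code → Fin B → Set
    In χ b = finToFun {2} {B} χ b ≡ Fin.suc Fin.zero

    -- The M-periodic extension of a subset of the box.
    Ext : Fin Code → Pred Pt 0ℓ
    Ext χ x = ∃[ b ] In χ b × x ≋ pt b

    Ext? : ∀ χ → Decidable (Ext χ)
    Ext? χ x = Fin.any? λ b → (finToFun χ b Fin.≟ Fin.suc Fin.zero) ×-dec (x ≋? pt b)

    Ext-resp : ∀ χ → Ext χ Respects _≋_
    Ext-resp χ x≋y (b , χb , x≋b) = b , χb , ≋-trans (≋-sym x≋y) x≋b

    bit : ∀ {p} {P : Set p} → Dec P → Fin 2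
    bit (yes _) = Fin.suc Fin.zero
    bit (no  _) = Fin.zero

    bit⁻ : ∀ {p} {P : Set p} (d : Dec P) → bit d ≡ Fin.suc Fin.zero → P
    bit⁻ (yes p) _ = p

    bit⁺ : ∀ {p} {P : Set p} (d : Dec P) → P → bit d ≡ Fin.suc Fin.zero
    bit⁺ (yes _) _ = refl
    bit⁺ (no ¬p) p = contradiction p ¬p

    bit-cong : ∀ {p q} {P : Set p} {Q : Set q} (d : Dec P) (d′ : Dec Q) →
               (P → Q) → (Q → P) → bit d ≡ bit d′
    bit-cong (yes _) (yes _) _ _ = refl
    bit-cong (yes p) (no ¬q) f _ = contradiction (f p) ¬q
    bit-cong (no ¬p) (yes q) _ g = contradiction (g q) ¬p
    bit-cong (no _)  (no _)  _ _ = refl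

    funToFin-cong : ∀ {k l} {g h : Fin k → Fin l} → (∀ i → g i ≡ h i) → funToFin g ≡ funToFin h
    funToFin-cong {zero}  eq = refl
    funToFin-cong {suc k} eq = cong₂ Fin.combine (eq Fin.zero) (funToFin-cong (eq ∘ Fin.suc))

    Indexed : Setoid (Level.suc 0ℓ) 0ℓ
    Indexed = subringsOfIndex n m
    open Setoid Indexed using () renaming (Carrier to Sub; _≈_ to _≈ˢ_)

    module G (S : Sub) = Given (proj₁ S) (proj₂ S)

    code : Sub → Fin Code
    code S = funToFin (λ b → bit (G.Member? S (pt b)))

    code-bit : ∀ S b → finToFun (code S) b ≡ bit (G.Member? S (pt b))
    code-bit S b = Fin.finToFun-funToFin (λ b → bit (G.Member? S (pt b))) b

    In-code⁻ : ∀ S b → In (code S) b → Member (proj₁ S) (pt b)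
    In-code⁻ S b χb = bit⁻ (G.Member? S (pt b)) (trans (sym (code-bit S b)) χb)

    In-code⁺ : ∀ S b → Member (proj₁ S) (pt b) → In (code S) b
    In-code⁺ S b p = trans (code-bit S b) (bit⁺ (G.Member? S (pt b)) p)

    Ext-code : ∀ S → Ext (code S) ≐ Member (proj₁ S)
    Ext-code S =
        (λ (b , χb , x≋b) → G.Member-resp S (≋-sym x≋b) (In-code⁻ S b χb))
      , (λ {x} mx → red x , In-code⁺ S (red x) (G.Member-resp S (red-≋ x) mx) , red-≋ x)

    code-cong : ∀ {S T} → S ≈ˢ T → code S ≡ code T
    code-cong {S} {T} (S⊆T , T⊆S) = funToFin-cong λ b →
      bit-cong (G.Member? S (pt b)) (G.Member? T (pt b)) S⊆T T⊆S

    code-injective : ∀ {S T} → code S ≡ code T → S ≈ˢ T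
    code-injective {S} {T} eq =
      ≐-trans (≐-sym (Ext-code S)) (subst (λ χ → Ext χ ≐ Member (proj₁ T)) (sym eq) (Ext-code T))

    Recognised : Fin Code → Set
    Recognised χ = Closed (Ext χ) × (∀ b → Ext χ (pt b) → In χ b)

    recognised? : Decidable Recognised
    recognised? χ = closed? (Ext-resp χ) (Ext? χ)
      ×-dec Fin.all? λ b → Ext? χ (pt b) →-dec (finToFun χ b Fin.≟ Fin.suc Fin.zero)

    Closed-resp : ∀ {P Q : Pred Pt 0ℓ} → P ≐ Q → Closed P → Closed Q
    Closed-resp (P⊆Q , Q⊆P) c = record
      { zero∈ = P⊆Q zero∈
      ; one∈  = P⊆Q one∈
      ; sum∈  = λ x y p q → P⊆Q (sum∈ x y (Q⊆P p) (Q⊆P q))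
      ; neg∈  = λ x p → P⊆Q (neg∈ x (Q⊆P p))
      ; mul∈  = λ x y p q → P⊆Q (mul∈ x y (Q⊆P p) (Q⊆P q))
      ; reps  = proj₁ reps , record
        { distinct = λ i j p → distinct i j (Q⊆P p)
        ; covers   = λ x → proj₁ (covers x) , P⊆Q (proj₂ (covers x))
        }
      }
      where
      open Closed c
      open Transversal (proj₂ reps)

    two-valued : (a b : Fin 2) → (a ≡ Fin.suc Fin.zero → b ≡ Fin.suc Fin.zero) →
                 (b ≡ Fin.suc Fin.zero → a ≡ Fin.suc Fin.zero) → a ≡ b
    two-valued Fin.zero           Fin.zero           f g = refl
    two-valued Fin.zero           (Fin.suc Fin.zero) f g = g refl
    two-valued (Fin.suc Fin.zero) Fin.zero           f g = sym (f refl)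
    two-valued (Fin.suc Fin.zero) (Fin.suc Fin.zero) f g = refl

    ext : ∀ χ ψ → (∀ b → In χ b → In ψ b) → (∀ b → In ψ b → In χ b) → χ ≡ ψ
    ext χ ψ f g = trans (sym (Fin.funToFin-finToFin {B} {2} χ))
      (trans (funToFin-cong {B} {2} {finToFun χ} {finToFun ψ}
               (λ b → two-valued (finToFun χ b) (finToFun ψ b) (f b) (g b)))
             (Fin.funToFin-finToFin {B} {2} ψ))

    inImage? : ∀ χ → Dec (∃[ S ] code S ≡ χ)
    inImage? χ = map′ sound complete (recognised? χ)
      where
      sound : Recognised χ → ∃[ S ] code S ≡ χ
      sound (c , full) = S , ext (code S) χ
        (λ b p → full b (In-code⁻ S b p))
        (λ b p → In-code⁺ S b (b , p , ≋-refl))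
        where
        S : Sub
        S = toIndexed (Ext-resp χ) (Ext? χ) c
      complete : ∃[ S ] code S ≡ χ → Recognised χ
      complete (S , eq) = subst Recognised eq
        ( Closed-resp (≐-sym (Ext-code S)) (G.closed S)
        , λ b p → In-code⁺ S b (proj₁ (Ext-code S) p))

abstract
  finitelyManySubrings : (n m : ℕ) → ∃[ N ] Inverse (subringsOfIndex n m) (≡.setoid (Fin N))
  finitelyManySubrings n m = FiniteImage.finite (subringsOfIndex n m) code
    (λ {S} {T} → code-cong {S} {T}) (λ {S} {T} → code-injective {S} {T}) inImage?
    where open Enumeration n m

f : (n m : ℕ) → ℕ
f n m = proj₁ (finitelyManySubrings n m)

f-counts : ∀ n m → Inverse (subringsOfIndex n m) (≡.setoid (Fin (f n m)))
f-counts n m = proj₂ (finitelyManySubrings n m)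

------------------------------------------------------------------------

⌈_/_⌉ : (a b : ℕ) .{{_ : NonZero b}} → ℕ
⌈ a / b ⌉ = (a ℕ.+ (b ∸ 1)) / b

⌊_/_⌋ : (a b : ℕ) .{{_ : NonZero b}} → ℕ
⌊ a / b ⌋ = a / b

-- k, c, b and the value are integers: no subtraction is truncated.
objective : (e n t : ℕ) .{{_ : NonZero t}} → ℤ
objective e n t =
  k * (+ n - 1ℤ) - c * c * (k + + t - c * + t) - b * b * (c * + t - k)
  where
  open import Data.Integer.Base using (_+_; _-_; _*_)
  k c b : ℤ
  k = + e - + t * (+ n - 1ℤ)
  c = + ⌈ e / t ⌉ - (+ n - 1ℤ)
  b = + ⌊ e / t ⌋ - (+ n - 1ℤ)

-- max { g t | lo ≤ t ≤ hi }, provided lo ≤ hi: the list runs over s = t - 1, and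
-- the value at hi only serves as a starting value.
maxOver : (g : (t : ℕ) .{{_ : NonZero t}} → ℤ) (lo hi : ℕ) .{{_ : NonZero hi}} → ℤ
maxOver g lo hi =
  Extrema.max (g hi) (List.map (λ s → g (suc s)) (filter (λ s → lo ℕ.≤? suc s) (upTo hi)))

maxOver-attained : ∀ (g : (t : ℕ) .{{_ : NonZero t}} → ℤ) lo hi .{{_ : NonZero hi}} → lo ℕ.≤ hi →
                   Σ[ t ∈ ℕ ] Σ[ t≢0 ∈ NonZero t ] lo ℕ.≤ t × t ℕ.≤ hi × maxOver g lo hi ≡ g t {{t≢0}}
maxOver-attained g lo hi@(suc _) lo≤hi
  with Extrema.argmax-sel (λ v → v) (g hi)
         (List.map (λ s → g (suc s)) (filter (λ s → lo ℕ.≤? suc s) (upTo hi)))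
... | inj₁ eq = hi , _ , lo≤hi , ℕ.≤-refl , eq
... | inj₂ v∈ with s , s∈ , eq ← ∈-map⁻ (λ s → g (suc s)) v∈
              with s∈upTo , lo≤ ← ∈-filter⁻ (λ s → lo ℕ.≤? suc s) {xs = upTo hi} s∈ =
  suc s , _ , lo≤ , ∈-upTo⁻ s∈upTo , eq

maxOver-upper : ∀ (g : (t : ℕ) .{{_ : NonZero t}} → ℤ) lo hi .{{_ : NonZero hi}} →
                ∀ t .{{_ : NonZero t}} → lo ℕ.≤ t → t ℕ.≤ hi → g t ℤ.≤ maxOver g lo hi
maxOver-upper g lo hi (suc s) lo≤t t≤hi =
  All.lookup (Extrema.xs≤max (g hi) (List.map (λ s → g (suc s)) (filter (λ s → lo ℕ.≤? suc s) (upTo hi))))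
    (∈-map⁺ (λ s → g (suc s)) (∈-filter⁺ (λ s → lo ℕ.≤? suc s) (∈-upTo⁺ t≤hi) lo≤t))

n-1≢0 : ∀ {n} → 1 ℕ.< n → NonZero (n ∸ 1)
n-1≢0 1<n = ℕ.>-nonZero (ℕ.m<n⇒0<n∸m 1<n)

tMin : (e n : ℕ) → 1 ℕ.< n → ℕ
tMin e n 1<n = ⌈ e / 2 ℕ.* (n ∸ 1) ⌉
  where instance _ = ℕ.m*n≢0 2 (n ∸ 1) {{_}} {{n-1≢0 1<n}}

tMax : (e n : ℕ) → 1 ℕ.< n → ℕ
tMax e n 1<n = ⌊ e / n ∸ 1 ⌋
  where instance _ = n-1≢0 1<n

tMax≢0 : ∀ {e n} → (1<n : 1 ℕ.< n) → n ∸ 1 ℕ.≤ e → NonZero (tMax e n 1<n)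
tMax≢0 1<n n-1≤e = ℕ.>-nonZero (m≥n⇒m/n>0 {{n-1≢0 1<n}} n-1≤e)

h : (e n : ℕ) → 1 ℕ.< n → n ∸ 1 ℕ.≤ e → ℤ
h e n 1<n n-1≤e = maxOver (objective e n) (tMin e n 1<n) (tMax e n 1<n)
  where instance _ = tMax≢0 1<n n-1≤e

tMin≤tMax : ∀ e n (1<n : 1 ℕ.< n) → n ∸ 1 ℕ.≤ e → tMin e n 1<n ℕ.≤ tMax e n 1<n
tMin≤tMax e n 1<n n-1≤e = ℕ.<⇒≤pred (m<n*o⇒m/o<n bound)
  where
  open import Data.Nat.Base using (_+_; _*_)
  d q r : ℕ
  d = n ∸ 1
  instance
    d≢0 : NonZero d
    d≢0 = n-1≢0 1<n
    2d≢0 : NonZero (2 * d)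
    2d≢0 = ℕ.m*n≢0 2 d
  q = e / d
  r = e % d
  bound : e + (2 * d ∸ 1) ℕ.< suc q * (2 * d)
  bound = begin-strict
    e + (2 * d ∸ 1)             <⟨ ℕ.+-monoʳ-< e (ℕ.≤-reflexive (ℕ.m+[n∸m]≡n (ℕ.>-nonZero⁻¹ (2 * d)))) ⟩
    e + 2 * d                   ≤⟨ ℕ.+-monoˡ-≤ (2 * d) e≤ ⟩
    q * (2 * d) + 2 * d         ≡⟨ ℕ.+-comm (q * (2 * d)) (2 * d) ⟩
    suc q * (2 * d)             ∎
    where
    open ℕ.≤-Reasoning
    lem : ∀ q d → q * d + q * d ≡ q * (2 * d)
    lem q d = trans (sym (ℕ.*-distribˡ-+ q d d)) (cong (λ v → q * (d + v)) (sym (ℕ.+-identityʳ d)))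
    e≤ : e ℕ.≤ q * (2 * d)
    e≤ = begin
      e                ≡⟨ m≡m%n+[m/n]*n e d ⟩
      r + q * d        ≤⟨ ℕ.+-monoˡ-≤ (q * d) (ℕ.<⇒≤ (m%n<n e d)) ⟩
      d + q * d        ≤⟨ ℕ.+-monoˡ-≤ (q * d) (ℕ.m≤n*m d q {{ℕ.>-nonZero (m≥n⇒m/n>0 n-1≤e)}}) ⟩
      q * d + q * d    ≡⟨ lem q d ⟩
      q * (2 * d)      ∎

-- Rational-valued, because h is an integer with no sign condition built in.
infixr 8 _^ᶻ_
_^ᶻ_ : (p : ℕ) .{{_ : NonZero p}} → ℤ → ℚᵘ
p ^ᶻ (+ k)    = + (p ℕ.^ k) ℚᵘ./ 1
p ^ᶻ -[1+ k ] = ℚᵘ._/_ 1ℤ (p ℕ.^ suc k) {{ℕ.m^n≢0 p (suc k)}}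

{-# OPTIONS --safe #-}
-- Let d = n - 1, let t attain the maximum, and write k = b t + r with 0 ≤ r ≤ t,
-- d = b + 1 + g and t = r + s.  Put q = p^t, R = p^r, S = p^s.  In terms of the
-- differences y = (x₁ - x₀, …, x_d - x₀) = (v, u₁, …, u_b, w₁, …, w_g), the
-- congruences
--   w_j ≡ 0 (mod q),   v′ := v - Σ β_j w_j ≡ 0 (mod q R),
--   u_i - α_i v′ - Σ A_ij w_j ≡ 0 (mod q²)
-- define a lattice between q² ℤᵈ and q ℤᵈ, so the x satisfying them form a subring.
-- The system is unitriangular, so its index is q R q^(2b) q^g = p^e.  The lattice
-- determines β mod R, then α mod S and A mod q, and the number of these choices,
-- R^g S^b q^(b g), is p to the power of the objective at t.
module Submission where

open import Defs
open import Data.Empty using (⊥-elim)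
open import Data.Fin.Base using (Fin; zero; suc; toℕ; fromℕ<; combine; remQuot; finToFun; funToFin;
  splitAt; _↑ˡ_; _↑ʳ_)
import Data.Fin.Base as Fin
import Data.Fin.Properties as Fin
open import Data.Integer.Base using (ℤ; +_; 0ℤ; 1ℤ; -1ℤ; _+_; _-_; _*_; -_)
import Data.Integer.Base as ℤ
open import Data.Integer.DivMod using (_%ℕ_; _/ℕ_; n%ℕd<d; a≡a%ℕn+[a/ℕn]*n)
open import Data.Integer.Divisibility.Signed
import Data.Integer.Properties as ℤ
open import Data.Integer.Tactic.RingSolver using (solve-∀)
open import Data.Nat.Base using (ℕ; NonZero; _∸_; _^_; _≤_; _<_)
import Data.Nat.Base as ℕ
import Data.Nat.Divisibility as ℕ
import Data.Nat.DivMod as ℕ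
open import Data.Nat.Primality using (Prime; prime⇒nonZero)
import Data.Nat.Properties as ℕ
import Data.Nat.Tactic.RingSolver as ℕSolver
open import Data.Product using (_×_; _,_; proj₁; proj₂; uncurry; ∃-syntax)
open import Data.Rational.Unnormalised.Base using (_/_) renaming (_≥_ to _≥ℚ_)
import Data.Rational.Unnormalised.Base as ℚᵘ
open import Data.Sum.Base using (_⊎_; inj₁; inj₂; [_,_])
open import Data.Unit.Base using (⊤; tt)
open import Data.Vec.Functional using (Vector; _∷_; _++_; replicate)
open import Data.Vec.Functional.Properties using (lookup-++ˡ; lookup-++ʳ)
open import Function.Base using (_∘_; const)
open import Function.Bundles using (Inverse)
import Function.Construct.Composition as Composition
open import Level using (0ℓ)
open import Relation.Binary.Bundles using (Setoid)
open import Relation.Binary.PropositionalEquality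
  using (_≡_; _≗_; refl; sym; trans; cong; cong₂; subst; subst₂; setoid; module ≡-Reasoning)
open import Algebra.Properties.CommutativeMonoid.Sum ℤ.+-0-commutativeMonoid
  using (sum; sum-cong-≗; ∑-distrib-+)
open import Algebra.Properties.Semiring.Sum ℤ.+-*-semiring using (*-distribˡ-sum)

-- Congruences and systems of residues.

∣-diff-sym : ∀ {m} a b → m ∣ a - b → m ∣ b - a
∣-diff-sym {m} a b p = subst (m ∣_) (eq a b) (∣m⇒∣-m p)
  where
  eq : ∀ a b → - (a - b) ≡ b - a
  eq = solve-∀

∣-diff-trans : ∀ {m} a b c → m ∣ a - b → m ∣ b - c → m ∣ a - c
∣-diff-trans {m} a b c p q = subst (m ∣_) (eq a b c) (∣m∣n⇒∣m+n p q)
  where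
  eq : ∀ a b c → (a - b) + (b - c) ≡ a - c
  eq = solve-∀

∣-diff-refl : ∀ {m} {a b : ℤ} → a ≡ b → m ∣ a - b
∣-diff-refl {m} {a} refl = subst (m ∣_) (sym (ℤ.+-inverseʳ a)) (divides 0ℤ refl)

-- The product of the groups ℤ/`m i`, kept as integer functions up to congruence; the cosets of a
-- congruence lattice are counted by comparison with it.
residues : (I : Set) (m : I → ℕ) → Setoid 0ℓ 0ℓ
residues I m = record
  { Carrier       = I → ℤ
  ; _≈_           = λ x y → ∀ i → + m i ∣ x i - y i
  ; isEquivalence = record
    { refl  = λ {x} i → ∣-diff-refl {a = x i} refl
    ; sym   = λ {x} {y} p i → ∣-diff-sym (x i) (y i) (p i)
    ; trans = λ {x} {y} {z} p q i → ∣-diff-trans (x i) (y i) (z i) (p i) (q i)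
    }
  }

Residues : (I : Set) (m : I → ℕ) (N : ℕ) → Set
Residues I m N = Inverse (residues I m) (setoid (Fin N))

module _ (m : ℕ) .{{_ : NonZero m}} where

  residue : ℤ → Fin m
  residue x = fromℕ< (n%ℕd<d x m)

  residue-∣ : ∀ x → + m ∣ x - + toℕ (residue x)
  residue-∣ x = divides (x /ℕ m) (begin
    x - + toℕ (residue x)
      ≡⟨ cong (λ v → x - + v) (Fin.toℕ-fromℕ< _) ⟩
    x - + (x %ℕ m)
      ≡⟨ cong (_- + (x %ℕ m)) (a≡a%ℕn+[a/ℕn]*n x m) ⟩
    + (x %ℕ m) + (x /ℕ m) * + m - + (x %ℕ m)
      ≡⟨ eq (+ (x %ℕ m)) ((x /ℕ m) * + m) ⟩
    (x /ℕ m) * + m ∎)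
    where
    open ≡-Reasoning
    eq : ∀ a b → a + b - a ≡ b
    eq = solve-∀

  private
    -- Two representatives differ by less than `m`, and the only multiple of `m` in that range is 0.
    -- The assumption on the order makes the truncated difference exact.
    toℕ-cancel-≤ : ∀ (i j : Fin m) → toℕ j ℕ.≤ toℕ i → + m ∣ + toℕ i - + toℕ j → i ≡ j
    toℕ-cancel-≤ i j j≤i p = Fin.toℕ-injective (ℕ.≤-antisym (ℕ.m∸n≡0⇒m≤n (small _ d<m d∣)) j≤i)
      where
      d∣ : m ℕ.∣ toℕ i ℕ.∸ toℕ j
      d∣ = ∣⇒∣ᵤ (subst (+ m ∣_) (trans (ℤ.m-n≡m⊖n (toℕ i) (toℕ j)) (ℤ.⊖-≥ j≤i)) p)
      d<m : toℕ i ℕ.∸ toℕ j ℕ.< m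
      d<m = ℕ.≤-<-trans (ℕ.m∸n≤m (toℕ i) (toℕ j)) (Fin.toℕ<n i)
      small : ∀ d → d ℕ.< m → m ℕ.∣ d → d ≡ 0
      small ℕ.zero    _   _   = refl
      small (ℕ.suc d) d<m m∣d = ⊥-elim (ℕ.>⇒∤ d<m m∣d)

  toℕ-cancel : ∀ (i j : Fin m) → + m ∣ + toℕ i - + toℕ j → i ≡ j
  toℕ-cancel i j p with ℕ.≤-total (toℕ j) (toℕ i)
  ... | inj₁ j≤i = toℕ-cancel-≤ i j j≤i p
  ... | inj₂ i≤j = sym (toℕ-cancel-≤ j i i≤j (∣-diff-sym (+ toℕ i) (+ toℕ j) p))

  residue-unique : ∀ x i → + m ∣ x - + toℕ i → residue x ≡ i
  residue-unique x i p = toℕ-cancel (residue x) i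
    (∣-diff-trans (+ toℕ (residue x)) x (+ toℕ i) (∣-diff-sym x (+ toℕ (residue x)) (residue-∣ x)) p)

  residue-cong : ∀ x y → + m ∣ x - y → residue x ≡ residue y
  residue-cong x y p = residue-unique x (residue y)
    (∣-diff-trans x y (+ toℕ (residue y)) p (residue-∣ y))

  residues-⊤ : Residues ⊤ (const m) m
  residues-⊤ = record
    { to        = λ x → residue (x tt)
    ; from      = λ i _ → + toℕ i
    ; to-cong   = λ {x} {y} p → residue-cong (x tt) (y tt) (p tt)
    ; from-cong = λ i≡j _ → ∣-diff-refl (cong (+_ ∘ toℕ) i≡j)
    ; inverse   = (λ {i} {x} p → residue-unique (x tt) i (p tt))
                , (λ { {x} refl _ → ∣-diff-sym (x tt) _ (residue-∣ (x tt)) })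
    }

  residues-Fin : ∀ k → Residues (Fin k) (const m) (m ℕ.^ k)
  residues-Fin k = record
    { to        = λ x → funToFin (residue ∘ x)
    ; from      = λ j i → + toℕ (finToFun {m} {k} j i)
    ; to-cong   = λ {x} {y} p → funToFin-cong (λ i → residue-cong (x i) (y i) (p i))
    ; from-cong = λ j≡j′ i → ∣-diff-refl (cong (λ j → + toℕ (finToFun {m} {k} j i)) j≡j′)
    ; inverse   = (λ {j} {x} p → trans (funToFin-cong (λ i → residue-unique (x i) _ (p i)))
                                       (Fin.funToFin-finToFin {k} {m} j))
                , (λ { {x} refl i → subst (λ r → + m ∣ + toℕ r - x i)
                         (sym (Fin.finToFun-funToFin {k} {m} (residue ∘ x) i))
                         (∣-diff-sym (x i) _ (residue-∣ (x i))) })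
    }
    where
    funToFin-cong : ∀ {k} {g h : Fin k → Fin m} → (∀ i → g i ≡ h i) → funToFin g ≡ funToFin h
    funToFin-cong {ℕ.zero}  eq = refl
    funToFin-cong {ℕ.suc k} eq = cong₂ combine (eq zero) (funToFin-cong (eq ∘ suc))

residues-⊎ : ∀ {I J : Set} {m : I → ℕ} {m′ : J → ℕ} {M N} →
             Residues I m M → Residues J m′ N → Residues (I ⊎ J) [ m , m′ ] (M ℕ.* N)
residues-⊎ {m = m} {m′} {M} {N} ρ σ = record
  { to        = λ x → combine (ρ.to (x ∘ inj₁)) (σ.to (x ∘ inj₂))
  ; from      = from
  ; to-cong   = λ p → cong₂ combine (ρ.to-cong (p ∘ inj₁)) (σ.to-cong (p ∘ inj₂))
  ; from-cong = λ k≡k′ i → ∣-diff-refl (cong (λ k → from k i) k≡k′)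
  ; inverse   = (λ {k} p → trans (cong₂ combine (ρ.inverseˡ (p ∘ inj₁)) (σ.inverseˡ (p ∘ inj₂)))
                                 (Fin.combine-remQuot {M} N k))
              , (λ { {x} refl (inj₁ i) → subst (λ jk → + m i ∣ ρ.from (proj₁ jk) i - x (inj₁ i))
                       (sym (Fin.remQuot-combine {M} {N} _ _)) (ρ.strictlyInverseʳ (x ∘ inj₁) i)
                   ; {x} refl (inj₂ j) → subst (λ jk → + m′ j ∣ σ.from (proj₂ jk) j - x (inj₂ j))
                       (sym (Fin.remQuot-combine {M} {N} _ _)) (σ.strictlyInverseʳ (x ∘ inj₂) j) })
  }
  where
  module ρ = Inverse ρ
  module σ = Inverse σ
  from : Fin (M ℕ.* N) → _ ⊎ _ → ℤ
  from k = [ ρ.from (proj₁ (remQuot {M} N k)) , σ.from (proj₂ (remQuot {M} N k)) ]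

-- Linear forms and coordinate vectors.

record Linear (d : ℕ) : Set where
  field
    ⟦_⟧    : Vector ℤ d → ℤ
    ⟦⟧-cong : ∀ {x y} → x ≗ y → ⟦ x ⟧ ≡ ⟦ y ⟧
    +-homo : ∀ x y → ⟦ (λ k → x k + y k) ⟧ ≡ ⟦ x ⟧ + ⟦ y ⟧
    *-homo : ∀ c x → ⟦ (λ k → c * x k) ⟧ ≡ c * ⟦ x ⟧

  -‿homo : ∀ x → ⟦ (λ k → - x k) ⟧ ≡ - ⟦ x ⟧
  -‿homo x = trans (⟦⟧-cong (λ k → sym (ℤ.-1*i≡-i (x k)))) (trans (*-homo -1ℤ x) (ℤ.-1*i≡-i ⟦ x ⟧))

  minus-homo : ∀ x y → ⟦ (λ k → x k - y k) ⟧ ≡ ⟦ x ⟧ - ⟦ y ⟧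
  minus-homo x y = trans (+-homo x (-_ ∘ y)) (cong (λ v → ⟦ x ⟧ + v) (-‿homo y))

open Linear using (⟦_⟧)

module _ {d : ℕ} where

  coordinate : Fin d → Linear d
  coordinate i = record
    { ⟦_⟧ = λ x → x i ; ⟦⟧-cong = λ x≗y → x≗y i ; +-homo = λ _ _ → refl ; *-homo = λ _ _ → refl }

  infixl 6 _⊖_
  _⊖_ : Linear d → Linear d → Linear d
  ℓ ⊖ ℓ′ = record
    { ⟦_⟧     = λ x → ⟦ ℓ ⟧ x - ⟦ ℓ′ ⟧ x
    ; ⟦⟧-cong = λ x≗y → cong₂ _-_ (ℓ.⟦⟧-cong x≗y) (ℓ′.⟦⟧-cong x≗y)
    ; +-homo  = λ x y → trans (cong₂ _-_ (ℓ.+-homo x y) (ℓ′.+-homo x y))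
                              (add (⟦ ℓ ⟧ x) (⟦ ℓ ⟧ y) (⟦ ℓ′ ⟧ x) (⟦ ℓ′ ⟧ y))
    ; *-homo  = λ c x → trans (cong₂ _-_ (ℓ.*-homo c x) (ℓ′.*-homo c x))
                              (scale c (⟦ ℓ ⟧ x) (⟦ ℓ′ ⟧ x))
    }
    where
    module ℓ = Linear ℓ
    module ℓ′ = Linear ℓ′
    add : ∀ a b c d → (a + b) - (c + d) ≡ (a - c) + (b - d)
    add = solve-∀
    scale : ∀ c a b → c * a - c * b ≡ c * (a - b)
    scale = solve-∀

  infixr 7 _•_
  _•_ : ℤ → Linear d → Linear d
  a • ℓ = record
    { ⟦_⟧     = λ x → a * ⟦ ℓ ⟧ x
    ; ⟦⟧-cong = λ x≗y → cong (a *_) (ℓ.⟦⟧-cong x≗y)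
    ; +-homo  = λ x y → trans (cong (a *_) (ℓ.+-homo x y)) (ℤ.*-distribˡ-+ a (⟦ ℓ ⟧ x) (⟦ ℓ ⟧ y))
    ; *-homo  = λ c x → trans (cong (a *_) (ℓ.*-homo c x)) (swap a c (⟦ ℓ ⟧ x))
    }
    where
    module ℓ = Linear ℓ
    swap : ∀ a c x → a * (c * x) ≡ c * (a * x)
    swap = solve-∀

  ∑ : ∀ {g} → (Fin g → Linear d) → Linear d
  ∑ ℓ = record
    { ⟦_⟧     = λ x → sum (λ j → ⟦ ℓ j ⟧ x)
    ; ⟦⟧-cong = λ x≗y → sum-cong-≗ (λ j → Linear.⟦⟧-cong (ℓ j) x≗y)
    ; +-homo  = λ x y → trans (sum-cong-≗ (λ j → Linear.+-homo (ℓ j) x y))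
                              (∑-distrib-+ (λ j → ⟦ ℓ j ⟧ x) (λ j → ⟦ ℓ j ⟧ y))
    ; *-homo  = λ c x → trans (sum-cong-≗ (λ j → Linear.*-homo (ℓ j) c x))
                              (sym (*-distribˡ-sum c (λ j → ⟦ ℓ j ⟧ x)))
    }

∣-sum : ∀ {q g} (x : Vector ℤ g) → (∀ j → q ∣ x j) → q ∣ sum x
∣-sum {g = ℕ.zero}  x q∣ = divides 0ℤ refl
∣-sum {g = ℕ.suc g} x q∣ = ∣m∣n⇒∣m+n (q∣ zero) (∣-sum (x ∘ suc) (q∣ ∘ suc))

-- A multiple of a standard basis vector, used below to build test points.
single : ∀ {g} → Fin g → ℤ → Vector ℤ g
single zero    c = c ∷ replicate _ 0ℤ
single (suc j) c = 0ℤ ∷ single j c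

∣-single : ∀ {g} c (j k : Fin g) → c ∣ single j c k
∣-single c zero    zero    = ∣-refl
∣-single c zero    (suc k) = divides 0ℤ refl
∣-single c (suc j) zero    = divides 0ℤ refl
∣-single c (suc j) (suc k) = ∣-single c j k

sum-*0 : ∀ {g} (x : Vector ℤ g) → sum (λ k → x k * 0ℤ) ≡ 0ℤ
sum-*0 {ℕ.zero}  x = refl
sum-*0 {ℕ.suc g} x = cong₂ _+_ (ℤ.*-zeroʳ (x zero)) (sum-*0 (x ∘ suc))

sum-*single : ∀ {g} (x : Vector ℤ g) j c → sum (λ k → x k * single j c k) ≡ x j * c
sum-*single x zero    c = trans (cong (λ v → x zero * c + v) (sum-*0 (x ∘ suc))) (ℤ.+-identityʳ _)
sum-*single x (suc j) c =
  trans (cong₂ _+_ (ℤ.*-zeroʳ (x zero)) (sum-*single (x ∘ suc) j c)) (ℤ.+-identityˡ _)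

-- Subrings defined by congruences on coordinate differences.

module CongruenceSubring {d : ℕ} {I : Set} (m : I → ℕ) (q : ℤ) (ℓ : I → Linear d)
  (coordinates : ∀ y → (∀ i → + m i ∣ ⟦ ℓ i ⟧ y) → ∀ k → q ∣ y k)
  (m∣q² : ∀ i → + m i ∣ q * q)
  where

  module ℓ i = Linear (ℓ i)

  δ : (Fin (ℕ.suc d) → ℤ) → Vector ℤ d
  δ x k = x (suc k) - x zero

  InLattice : Vector ℤ d → Set
  InLattice y = ∀ i → + m i ∣ ⟦ ℓ i ⟧ y

  In-resp : ∀ {x y} → x ≗ y → InLattice x → InLattice y
  In-resp x≗y p i = subst (+ m i ∣_) (ℓ.⟦⟧-cong i x≗y) (p i)

  In-+ : ∀ {x y} → InLattice x → InLattice y → InLattice (λ k → x k + y k)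
  In-+ {x} {y} p q i = subst (+ m i ∣_) (sym (ℓ.+-homo i x y)) (∣m∣n⇒∣m+n (p i) (q i))

  In-* : ∀ c {x} → InLattice x → InLattice (λ k → c * x k)
  In-* c {x} p i = subst (+ m i ∣_) (sym (ℓ.*-homo i c x)) (∣n⇒∣m*n c (p i))

  In-q² : ∀ y → InLattice (λ k → q * q * y k)
  In-q² y i = subst (+ m i ∣_) (sym (ℓ.*-homo i (q * q) y)) (∣m⇒∣m*n (⟦ ℓ i ⟧ y) (m∣q² i))

  In-0 : InLattice (const 0ℤ)
  In-0 = In-resp (λ k → refl) (In-* 0ℤ (In-q² (const 0ℤ)))

  subring : Subring (ℤ^ (ℕ.suc d)) 0ℓ
  subring = record
    { Member   = InLattice ∘ δ
    ; resp     = λ x≈y → In-resp (λ k → cong₂ _-_ (x≈y (suc k)) (x≈y zero))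
    ; 0#-mem   = In-0
    ; +-closed = λ {x} {y} p q → In-resp (λ k → add (x (suc k)) (x zero) (y (suc k)) (y zero)) (In-+ p q)
    ; -‿closed = λ {x} p → In-resp (λ k → neg (x (suc k)) (x zero)) (In-* -1ℤ p)
    ; 1#-mem   = In-0
    ; *-closed = λ {x} {y} → mul {x} {y}
    }
    where
    add : ∀ a b c d → (a - b) + (c - d) ≡ (a + c) - (b + d)
    add = solve-∀
    neg : ∀ a b → -1ℤ * (a - b) ≡ - a - - b
    neg = solve-∀
    mul : ∀ {x y} → InLattice (δ x) → InLattice (δ y) → InLattice (δ (λ k → x k * y k))
    -- Uses x_k y_k - x₀ y₀ = (x_k - x₀)(y_k - y₀) + x₀ (y_k - y₀) + y₀ (x_k - x₀). Both factors of
    -- the first summand are multiples of `q`, so it is covered by `In-q²`; the other two are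
    -- multiples of lattice points.
    mul {x} {y} p r = In-resp
      (λ k → trans (cong (_+ (x zero * δ y k + y zero * δ x k))
                     (trans (rearrange q (a k) (b k))
                       (cong₂ _*_ (sym (_∣_.equality (q∣x k))) (sym (_∣_.equality (q∣y k))))))
                   (expand (x (suc k)) (x zero) (y (suc k)) (y zero)))
      (In-+ (In-q² (λ k → a k * b k)) (In-+ (In-* (x zero) r) (In-* (y zero) p)))
      where
      q∣x = coordinates (δ x) p
      q∣y = coordinates (δ y) r
      a b : Vector ℤ d
      a k = _∣_.quotient (q∣x k)
      b k = _∣_.quotient (q∣y k)
      rearrange : ∀ q a b → q * q * (a * b) ≡ (a * q) * (b * q)
      rearrange = solve-∀
      expand : ∀ a b c d → (a - b) * (c - d) + (b * (c - d) + d * (a - b)) ≡ a * c - b * d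
      expand = solve-∀

  module _ (section : (I → ℤ) → Vector ℤ d) (section-ℓ : ∀ z i → ⟦ ℓ i ⟧ (section z) ≡ z i) where

    δ-member : ∀ y → Member subring (0ℤ ∷ y) → InLattice y
    δ-member y = In-resp (λ k → ℤ.+-identityʳ (y k))

    member-δ : ∀ y → InLattice y → Member subring (0ℤ ∷ y)
    member-δ y = In-resp (λ k → sym (ℤ.+-identityʳ (y k)))

    -- Membership says exactly that every form vanishes modulo its `m i`, so the values of the forms
    -- separate cosets; the right inverse `section` reaches every system of residues. The index
    -- follows without a determinant.
    cosets↔residues : Inverse (cosets subring) (residues I m)
    cosets↔residues = record
      { to        = to
      ; from      = from
      ; to-cong   = λ {x} {y} → to-cong x y
      ; from-cong = λ {z} {w} p → reflect (from z) (from w) λ i →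
          subst₂ (λ v u → + m i ∣ v - u) (sym (to-from z i)) (sym (to-from w i)) (p i)
      ; inverse   = (λ {z} {x} p i → subst (λ v → + m i ∣ to x i - v) (to-from z i) (to-cong x (from z) p i))
                  , (λ {x} {z} p → reflect (from z) x λ i →
                      subst (λ v → + m i ∣ v - to x i) (sym (to-from z i)) (p i))
      }
      where
      to : (Fin (ℕ.suc d) → ℤ) → I → ℤ
      to x i = ⟦ ℓ i ⟧ (δ x)
      from : (I → ℤ) → Fin (ℕ.suc d) → ℤ
      from z = 0ℤ ∷ section z
      to-from : ∀ z i → to (from z) i ≡ z i
      to-from z i = trans (ℓ.⟦⟧-cong i (λ k → ℤ.+-identityʳ (section z k))) (section-ℓ z i)
      δ-diff : ∀ x y i → ⟦ ℓ i ⟧ (δ (λ k → x k - y k)) ≡ to x i - to y i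
      δ-diff x y i = trans (ℓ.⟦⟧-cong i (λ k → sub (x (suc k)) (y (suc k)) (x zero) (y zero)))
                             (ℓ.minus-homo i (δ x) (δ y))
        where
        sub : ∀ a b c d → (a - b) - (c - d) ≡ (a - c) - (b - d)
        sub = solve-∀
      to-cong : ∀ x y → Member subring (λ k → x k - y k) → ∀ i → + m i ∣ to x i - to y i
      to-cong x y p i = subst (+ m i ∣_) (δ-diff x y i) (p i)
      reflect : ∀ x y → (∀ i → + m i ∣ to x i - to y i) → Member subring (λ k → x k - y k)
      reflect x y p i = subst (+ m i ∣_) (sym (δ-diff x y i)) (p i)

    hasIndex : ∀ {N} → Residues I m N → HasIndex subring N
    hasIndex ρ = Composition.inverse cosets↔residues ρ

-- The family of lattices and their index.

module Family (b g R S : ℕ) .{{R≢0 : NonZero R}} .{{S≢0 : NonZero S}} where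

  d q : ℕ
  d = ℕ.suc (b ℕ.+ g)
  q = R ℕ.* S

  index : ℕ
  index = q ℕ.* R ℕ.* ((q ℕ.* q) ℕ.^ b ℕ.* q ℕ.^ g)

  private instance
    q≢0 : NonZero q
    q≢0 = ℕ.m*n≢0 R S
    qR≢0 : NonZero (q ℕ.* R)
    qR≢0 = ℕ.m*n≢0 q R
    q²≢0 : NonZero (q ℕ.* q)
    q²≢0 = ℕ.m*n≢0 q q

  -- `middle`, `upper i` and `lower j` label the congruences for v, u_i and w_j. The system is
  -- solved from `lower` through `middle` to `upper`, although v occupies the first coordinate.
  Row : Set
  Row = ⊤ ⊎ (Fin b ⊎ Fin g)

  pattern middle  = inj₁ tt
  pattern upper i = inj₂ (inj₁ i)
  pattern lower j = inj₂ (inj₂ j)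

  modulus : Row → ℕ
  modulus = [ const (q ℕ.* R) , [ const (q ℕ.* q) , const q ] ]

  position : Row → Fin d
  position middle    = zero
  position (upper i) = suc (i ↑ˡ g)
  position (lower j) = suc (b ↑ʳ j)

  record Parameters : Set where
    field
      β : Vector ℤ g
      α : Vector ℤ b
      A : Fin b → Vector ℤ g

  module _ (π : Parameters) where
    open Parameters π

    lowerForm : Fin g → Linear d
    lowerForm j = coordinate (position (lower j))

    middleForm : Linear d
    middleForm = coordinate (position middle) ⊖ ∑ (λ j → β j • lowerForm j)

    form : Row → Linear d
    form (lower j) = lowerForm j
    form middle    = middleForm
    form (upper i) = coordinate (position (upper i)) ⊖ α i • middleForm ⊖ ∑ (λ j → A i j • lowerForm j)

    upperPart : (Row → ℤ) → Vector ℤ b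
    upperPart z i = z (upper i) + α i * z middle + sum (λ j → A i j * z (lower j))

    -- Back substitution: w is read off, then v, then u. The system is unitriangular, so no division
    -- occurs and every integer right-hand side has a solution.
    section : (Row → ℤ) → Vector ℤ d
    section z = (z middle + sum (λ j → β j * z (lower j))) ∷ (upperPart z ++ (λ j → z (lower j)))

    section-lower : ∀ z j → ⟦ form (lower j) ⟧ (section z) ≡ z (lower j)
    section-lower z = lookup-++ʳ (upperPart z) (λ j → z (lower j))

    section-upper : ∀ z i → section z (position (upper i)) ≡ upperPart z i
    section-upper z = lookup-++ˡ (upperPart z) (λ j → z (lower j))

    sum-lower : ∀ (a : Vector ℤ g) z →
                sum (λ j → a j * ⟦ form (lower j) ⟧ (section z)) ≡ sum (λ j → a j * z (lower j))
    sum-lower a z = sum-cong-≗ (λ j → cong (a j *_) (section-lower z j))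

    form-section : ∀ z i → ⟦ form i ⟧ (section z) ≡ z i
    form-section z (lower j) = section-lower z j
    form-section z middle    = trans (cong (λ s → section z zero - s) (sum-lower β z)) (cancel (z middle) _)
      where
      cancel : ∀ a s → a + s - s ≡ a
      cancel = solve-∀
    form-section z (upper i) = trans
      (cong₂ _-_ (cong₂ _-_ (section-upper z i) (cong (α i *_) (form-section z middle))) (sum-lower (A i) z))
      (cancel (z (upper i)) _ _)
      where
      cancel : ∀ a s t → a + s + t - s - t ≡ a
      cancel = solve-∀

    q∣modulus : ∀ i → + q ∣ + modulus i
    q∣modulus (lower j) = ∣-refl
    q∣modulus middle    = subst (+ q ∣_) (sym (ℤ.pos-* q R)) (∣m⇒∣m*n (+ R) ∣-refl)
    q∣modulus (upper i) = subst (+ q ∣_) (sym (ℤ.pos-* q q)) (∣m⇒∣m*n (+ q) ∣-refl)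

    modulus∣q² : ∀ i → + modulus i ∣ + q * + q
    modulus∣q² (lower j) = ∣m⇒∣m*n (+ q) ∣-refl
    -- `R` divides `q = R S`, hence `q R` divides `q²`.
    modulus∣q² middle    = subst (_∣ + q * + q) (sym (ℤ.pos-* q R))
      (*-monoʳ-∣ (+ q) (subst (+ R ∣_) (sym (ℤ.pos-* R S)) (∣m⇒∣m*n (+ S) ∣-refl)))
    modulus∣q² (upper i) = ∣-reflexive (ℤ.pos-* q q)

    -- Elimination modulo `q`: every modulus is a multiple of `q`, so `q` divides each w_j, then v,
    -- then each u_i.
    coordinates : ∀ y → (∀ i → + modulus i ∣ ⟦ form i ⟧ y) → ∀ k → + q ∣ y k
    coordinates y p = λ
      { zero    → at-middle
      ; (suc k) → subst (λ k → + q ∣ y (suc k)) (Fin.join-splitAt b g k) (at (splitAt b k)) }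
      where
      q∣ : ∀ i → + q ∣ ⟦ form i ⟧ y
      q∣ i = ∣-trans (q∣modulus i) (p i)
      q∣sum : ∀ (a : Vector ℤ g) → + q ∣ sum (λ j → a j * ⟦ form (lower j) ⟧ y)
      q∣sum a = ∣-sum _ (λ j → ∣n⇒∣m*n (a j) (q∣ (lower j)))
      add-back : ∀ {a c : ℤ} → + q ∣ a - c → + q ∣ c → + q ∣ a
      add-back {a} {c} r s = ∣m+n∣n⇒∣m {m = a} r (∣m⇒∣-m s)
      at-middle : + q ∣ y zero
      at-middle = add-back (q∣ middle) (q∣sum β)
      at : ∀ x → + q ∣ y (suc (Fin.join b g x))
      at (inj₁ i) = add-back (add-back (q∣ (upper i)) (q∣sum (A i))) (∣n⇒∣m*n (α i) (q∣ middle))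
      at (inj₂ j) = q∣ (lower j)

    open CongruenceSubring modulus (+ q) form coordinates modulus∣q²

    indexed : Setoid.Carrier (subringsOfIndex (ℕ.suc d) index)
    indexed = subring , hasIndex section form-section
      (residues-⊎ (residues-⊤ (q ℕ.* R)) (residues-⊎ (residues-Fin (q ℕ.* q) b) (residues-Fin q g)))

    section-member : ∀ z → (∀ i → + modulus i ∣ z i) → Member (proj₁ indexed) (0ℤ ∷ section z)
    section-member z p = member-δ section form-section (section z)
      λ i → subst (+ modulus i ∣_) (sym (form-section z i)) (p i)

    member⇒∣ : ∀ y → Member (proj₁ indexed) (0ℤ ∷ y) → ∀ i → + modulus i ∣ ⟦ form i ⟧ y
    member⇒∣ = δ-member section form-section

  -- The lattice determines the parameters.

  -- The points `section π z`, with each `z i` a multiple of `modulus i`, make up the lattice of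
  -- `π`. This is thus inclusion of lattices, in a form that can be evaluated at a chosen `z`.
  _⊆ᴸ_ : Parameters → Parameters → Set
  π ⊆ᴸ π′ = ∀ z → (∀ i → + modulus i ∣ z i) → ∀ i → + modulus i ∣ ⟦ form π′ i ⟧ (section π z)

  infixr 5 _▹_
  _▹_ : ℤ → Vector ℤ g → Row → ℤ
  (c ▹ w) middle    = c
  (c ▹ w) (upper i) = 0ℤ
  (c ▹ w) (lower j) = w j

  module _ {π π′ : Parameters} (π⊆π′ : π ⊆ᴸ π′) where
    private
      module π  = Parameters π
      module π′ = Parameters π′

    -- Its solution under `π` is the lattice point with w = q e_j, v = q β_j and u_i = q A_ij.
    lowerTest : Fin g → Row → ℤ
    lowerTest j = 0ℤ ▹ single j (+ q)

    ∣-lowerTest : ∀ j i → + modulus i ∣ lowerTest j i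
    ∣-lowerTest j middle    = divides 0ℤ refl
    ∣-lowerTest j (upper i) = divides 0ℤ refl
    ∣-lowerTest j (lower k) = ∣-single (+ q) j k

    -- At the test point the form v′ of `π′` takes the value q (β_j - β′_j), which must be divisible
    -- by `q R`; cancelling `q` leaves `R`.
    ⊆⇒β-congruent : ∀ j → + R ∣ π.β j - π′.β j
    ⊆⇒β-congruent j = *-cancelˡ-∣ (+ q)
      (subst₂ _∣_ (ℤ.pos-* q R) eq (π⊆π′ (lowerTest j) (∣-lowerTest j) middle))
      where
      eq : ⟦ form π′ middle ⟧ (section π (lowerTest j)) ≡ + q * (π.β j - π′.β j)
      eq = trans (cong₂ _-_ (cong (λ s → 0ℤ + s) (sum-*single π.β j (+ q)))
                            (trans (sum-lower π π′.β (lowerTest j)) (sum-*single π′.β j (+ q))))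
                 (lem (π.β j) (π′.β j) (+ q))
        where
        lem : ∀ a c q → 0ℤ + a * q - c * q ≡ q * (a - c)
        lem = solve-∀

    module _ (β≗β′ : π.β ≗ π′.β) where

      -- Once β is the same on both sides, the two systems share the form v′, and their upper
      -- congruences can be compared.
      middle-section : ∀ z → ⟦ form π′ middle ⟧ (section π z) ≡ z middle
      middle-section z = trans
        (cong (λ s → section π z zero - s)
          (sum-cong-≗ (λ j → cong (_* ⟦ form π (lower j) ⟧ (section π z)) (sym (β≗β′ j)))))
        (form-section π z middle)

      upper-section : ∀ z i → ⟦ form π′ (upper i) ⟧ (section π z)
        ≡ upperPart π z i - π′.α i * z middle - sum (λ j → π′.A i j * z (lower j))
      upper-section z i = cong₂ _-_
        (cong₂ _-_ (section-upper π z i) (cong (π′.α i *_) (middle-section z)))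
        (sum-lower π (π′.A i) z)

      -- The same test point, read in the upper row: the value q (A_ij - A′_ij) must be divisible by
      -- `q²`.
      ⊆⇒A-congruent : ∀ i j → + q ∣ π.A i j - π′.A i j
      ⊆⇒A-congruent i j = *-cancelˡ-∣ (+ q)
        (subst₂ _∣_ (ℤ.pos-* q q) eq (π⊆π′ (lowerTest j) (∣-lowerTest j) (upper i)))
        where
        eq : ⟦ form π′ (upper i) ⟧ (section π (lowerTest j)) ≡ + q * (π.A i j - π′.A i j)
        eq = trans (upper-section (lowerTest j) i)
          (trans (cong₂ _-_ (cong₂ _-_ (cong (λ s → 0ℤ + π.α i * 0ℤ + s) (sum-*single (π.A i) j (+ q)))
                                       refl)
                            (sum-*single (π′.A i) j (+ q)))
                 (lem (π.α i) (π′.α i) (π.A i j) (π′.A i j) (+ q)))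
          where
          lem : ∀ α α′ a c q → 0ℤ + α * 0ℤ + a * q - α′ * 0ℤ - c * q ≡ q * (a - c)
          lem = solve-∀

      ⊆⇒α-congruent : ∀ i → + S ∣ π.α i - π′.α i
      ⊆⇒α-congruent i = *-cancelˡ-∣ (+ (q ℕ.* R))
        (subst₂ _∣_ modulus-eq eq (π⊆π′ z ∣-z (upper i)))
        where
        z : Row → ℤ
        -- The point with w = 0 and v′ = q R, the least positive value allowed for v′. As q² = q R
        -- S, cancelling `q R` in the upper congruence leaves `S`.
        z = + (q ℕ.* R) ▹ const 0ℤ
        ∣-z : ∀ i → + modulus i ∣ z i
        ∣-z middle    = ∣-refl
        ∣-z (upper i) = divides 0ℤ refl
        ∣-z (lower j) = divides 0ℤ refl
        modulus-eq : + (q ℕ.* q) ≡ + (q ℕ.* R) * + S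
        modulus-eq = trans (cong +_ (sym (ℕ.*-assoc q R S))) (ℤ.pos-* (q ℕ.* R) S)
        eq : ⟦ form π′ (upper i) ⟧ (section π z) ≡ + (q ℕ.* R) * (π.α i - π′.α i)
        eq = trans (upper-section z i)
          (trans (cong₂ (λ s t → 0ℤ + π.α i * + (q ℕ.* R) + s - π′.α i * + (q ℕ.* R) - t)
                        (sum-*0 (π.A i)) (sum-*0 (π′.A i)))
                 (lem (π.α i) (π′.α i) (+ (q ℕ.* R))))
          where
          lem : ∀ a c m → 0ℤ + a * m + 0ℤ - c * m - 0ℤ ≡ m * (a - c)
          lem = solve-∀

  -- Counting the family.

  private
    βs : Residues (Fin g) (const R) (R ℕ.^ g)
    βs = residues-Fin R g

    αAs : Residues (Fin b ⊎ Fin (b ℕ.* g)) [ const S , const q ] (S ℕ.^ b ℕ.* q ℕ.^ (b ℕ.* g))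
    αAs = residues-⊎ (residues-Fin S b) (residues-Fin q (b ℕ.* g))

    module βs = Inverse βs
    module αAs = Inverse αAs

    from-injective : ∀ {I : Set} {m : I → ℕ} {N} (ρ : Residues I m N) (x y : Fin N) →
      (∀ i → + m i ∣ Inverse.from ρ x i - Inverse.from ρ y i) → x ≡ y
    from-injective ρ x y p =
      trans (sym (strictlyInverseˡ x)) (trans (to-cong p) (strictlyInverseˡ y))
      where open Inverse ρ

  parameters : Fin (R ℕ.^ g) → Fin (S ℕ.^ b ℕ.* q ℕ.^ (b ℕ.* g)) → Parameters
  parameters x y = record
    { β = βs.from x
    ; α = λ i → αAs.from y (inj₁ i)
    ; A = λ i j → αAs.from y (inj₂ (combine i j))
    }

  -- β comes first: its entries are chosen representatives modulo `R`, so congruence forces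
  -- equality, which the comparison of α and A requires.
  parameters-injective : ∀ {x y x′ y′} → parameters x y ⊆ᴸ parameters x′ y′ → x ≡ x′ × y ≡ y′
  parameters-injective {x} {y} {x′} {y′} ⊆ = x≡x′ , from-injective αAs y y′ λ
    { (inj₁ i) → ⊆⇒α-congruent {parameters x y} {parameters x′ y′} ⊆ β≗β′ i
    ; (inj₂ k) → A-congruent k (Fin.combine-surjective {b} {g} k) }
    where
    x≡x′ : x ≡ x′
    x≡x′ = from-injective βs x x′ (⊆⇒β-congruent {parameters x y} {parameters x′ y′} ⊆)
    β≗β′ : βs.from x ≗ βs.from x′
    β≗β′ j = cong (λ v → βs.from v j) x≡x′
    A-congruent : ∀ k → ∃[ i ] ∃[ j ] combine {b} {g} i j ≡ k →
                  + q ∣ αAs.from y (inj₂ k) - αAs.from y′ (inj₂ k)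
    A-congruent _ (i , j , refl) = ⊆⇒A-congruent {parameters x y} {parameters x′ y′} ⊆ β≗β′ i j

  count : ℕ
  count = R ℕ.^ g ℕ.* (S ℕ.^ b ℕ.* q ℕ.^ (b ℕ.* g))

  -- Equal numbers under `f-counts` mean equal subrings, hence an inclusion of lattices, hence equal
  -- parameters.
  count≤f : count ℕ.≤ f (ℕ.suc d) index
  count≤f = Fin.injective⇒≤ {f = to ∘ member} λ {k} {k′} eq →
    let x≡x′ , y≡y′ = parameters-injective (⊆ᴸ-params k k′ λ {x} → proj₁ (to-reflects k k′ eq) {x})
    in trans (sym (Fin.combine-remQuot {R ℕ.^ g} _ k))
         (trans (cong₂ combine x≡x′ y≡y′) (Fin.combine-remQuot {R ℕ.^ g} _ k′))
    where
    open Inverse (f-counts (ℕ.suc d) index)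
    open Setoid (subringsOfIndex (ℕ.suc d) index)
      using (Carrier; _≈_) renaming (sym to ≈-sym; trans to ≈-trans)
    params : Fin count → Parameters
    params k = uncurry parameters (remQuot (S ℕ.^ b ℕ.* q ℕ.^ (b ℕ.* g)) k)
    member : Fin count → Carrier
    member k = indexed (params k)
    to-reflects : ∀ k k′ → to (member k) ≡ to (member k′) → member k ≈ member k′
    to-reflects k k′ eq = ≈-trans {member k} {from (to (member k))} {member k′}
      (≈-sym {from (to (member k))} {member k} (inverseʳ refl)) (inverseʳ eq)
    ⊆ᴸ-params : ∀ k k′ → (∀ {x} → Member (proj₁ (member k)) x → Member (proj₁ (member k′)) x) →
                params k ⊆ᴸ params k′
    ⊆ᴸ-params k k′ ⊆ z p = member⇒∣ (params k′) (section (params k) z)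
      (⊆ {0ℤ ∷ section (params k) z} (section-member (params k) z p))

-- Rounded division.

quotient-unique : ∀ r q t .{{_ : NonZero t}} → r ℕ.< t → (r ℕ.+ q ℕ.* t) ℕ./ t ≡ q
quotient-unique r q t r<t = trans (ℕ.+-distrib-/-∣ʳ r (ℕ.n∣m*n q))
  (cong₂ ℕ._+_ (ℕ.m<n⇒m/n≡0 r<t) (ℕ.m*n/n≡m q t))

/≤⇒<* : ∀ m n t .{{_ : NonZero n}} → m ℕ./ n ℕ.≤ t → m ℕ.< ℕ.suc t ℕ.* n
/≤⇒<* m n t m/n≤t = begin-strict
  m                               ≡⟨ ℕ.m≡m%n+[m/n]*n m n ⟩
  m ℕ.% n ℕ.+ m ℕ./ n ℕ.* n      <⟨ ℕ.+-monoˡ-< _ (ℕ.m%n<n m n) ⟩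
  ℕ.suc (m ℕ./ n) ℕ.* n           ≤⟨ ℕ.*-monoˡ-≤ n (ℕ.s≤s m/n≤t) ⟩
  ℕ.suc t ℕ.* n                   ∎
  where open ℕ.≤-Reasoning

-- The floor of `m + (n - 1)` over `n` gives a strict bound m + n - 1 < (t + 1) n; its strictness
-- supplies the unit needed to cancel `n - 1`.
⌈/⌉≤⇒≤* : ∀ m n t .{{_ : NonZero n}} → ⌈ m / n ⌉ ℕ.≤ t → m ℕ.≤ t ℕ.* n
⌈/⌉≤⇒≤* m n@(ℕ.suc n-1) t ≤t = ℕ.+-cancelʳ-≤ n-1 m (t ℕ.* n) (ℕ.≤-pred (begin
  ℕ.suc (m ℕ.+ n-1)        ≤⟨ /≤⇒<* (m ℕ.+ n-1) n t ≤t ⟩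
  n ℕ.+ t ℕ.* n            ≡⟨ cong ℕ.suc (ℕ.+-comm n-1 (t ℕ.* n)) ⟩
  ℕ.suc (t ℕ.* n ℕ.+ n-1)  ∎))
  where open ℕ.≤-Reasoning

-- The remainder r may equal t, so that k = t (d + 1) is covered as well.
record Division (t d k : ℕ) : Set where
  constructor division
  field
    {b g r s} : ℕ
    d≡ : d ≡ b ℕ.+ g
    t≡ : t ≡ r ℕ.+ s
    k≡ : k ≡ b ℕ.* t ℕ.+ r

-- Here `d` stands for n - 2. The induction subtracts `t` from `k` until at most `t` is left, and
-- `b` counts the subtractions; at `d = 0` the hypothesis itself says `k ≤ t`.
divide : ∀ t d k → k ℕ.≤ t ℕ.* ℕ.suc d → Division t d k
divide t d k k≤ with ℕ.≤-total k t
... | inj₁ k≤t = division {b = 0} refl (sym (ℕ.m+[n∸m]≡n k≤t)) refl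
divide t ℕ.zero k k≤ | inj₂ t≤k =
  division {b = 0} refl (sym (ℕ.m+[n∸m]≡n (subst (k ℕ.≤_) (ℕ.*-identityʳ t) k≤))) refl
divide t (ℕ.suc d) k k≤ | inj₂ t≤k
  with divide t d (k ℕ.∸ t) (ℕ.≤-trans (ℕ.∸-monoˡ-≤ t k≤)
         (ℕ.≤-reflexive (trans (cong (ℕ._∸ t) (ℕ.*-suc t (ℕ.suc d))) (ℕ.m+n∸m≡n t _))))
... | division {b} {g} {r} d≡ t≡ k≡ = division {b = ℕ.suc b} (cong ℕ.suc d≡) t≡
  (trans (sym (ℕ.m+[n∸m]≡n t≤k)) (trans (cong (t ℕ.+_) k≡) (sym (ℕ.+-assoc t (b ℕ.* t) r))))

-- The objective as the exponent of the count.

objectiveOf : (d k c b t : ℤ) → ℤ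
objectiveOf d k c b t = k * d - c * c * (k + t - c * t) - b * b * (c * t - k)

module _ (b g r s : ℕ) where

  dim total exponent : ℕ
  dim      = ℕ.suc (b ℕ.+ g)
  total    = (r ℕ.+ s) ℕ.* dim ℕ.+ (b ℕ.* (r ℕ.+ s) ℕ.+ r)
  exponent = r ℕ.* g ℕ.+ (s ℕ.* b ℕ.+ (r ℕ.+ s) ℕ.* (b ℕ.* g))

  -- With e = `total` and n - 1 = `dim`, subtracting n - 1 from the rounded quotients of e by t
  -- gives those of k by t. Once they are known as `c′` and `b′`, only an integer polynomial
  -- remains.
  objective-split : .{{_ : NonZero (r ℕ.+ s)}} → ∀ c′ b′ →
    ⌈ total / r ℕ.+ s ⌉ ≡ c′ ℕ.+ dim → total ℕ./ (r ℕ.+ s) ≡ b′ ℕ.+ dim →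
    objective total (ℕ.suc dim) (r ℕ.+ s)
      ≡ objectiveOf (+ dim) (+ b * (+ r + + s) + + r) (+ c′) (+ b′) (+ r + + s)
  objective-split c′ b′ ceil floor = trans
    (cong₂ (λ c b → objectiveOf (+ dim) k (c - + dim) (b - + dim) t) (cong +_ ceil) (cong +_ floor))
    (trans (cong₂ (λ c b → objectiveOf (+ dim) k c b t) (cancel (+ c′) (+ dim)) (cancel (+ b′) (+ dim)))
           (cong (λ k → objectiveOf (+ dim) k (+ c′) (+ b′) t) k≡))
    where
    t k : ℤ
    t = + r + + s
    k = + total - t * + dim
    cancel : ∀ a b → a + b - b ≡ a
    cancel = solve-∀
    k≡ : k ≡ + b * t + + r
    k≡ = trans (cong₂ (λ u v → u + (v + + r) - t * + dim) (ℤ.pos-* (r ℕ.+ s) dim) (ℤ.pos-* b (r ℕ.+ s)))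
               (lem (t * + dim) (+ b * t + + r))
      where
      lem : ∀ a b → a + b - a ≡ b
      lem = solve-∀

  +exponent : + exponent ≡ + r * + g + (+ s * + b + (+ r + + s) * (+ b * + g))
  +exponent = cong₂ _+_ (ℤ.pos-* r g) (cong₂ _+_ (ℤ.pos-* s b)
    (trans (ℤ.pos-* (r ℕ.+ s) (b ℕ.* g)) (cong ((+ r + + s) *_) (ℤ.pos-* b g))))

  total-mod : total ≡ r ℕ.+ (b ℕ.+ dim) ℕ.* (r ℕ.+ s)
  total-mod = lem r s b dim
    where
    lem : ∀ r s b d → (r ℕ.+ s) ℕ.* d ℕ.+ (b ℕ.* (r ℕ.+ s) ℕ.+ r) ≡ r ℕ.+ (b ℕ.+ d) ℕ.* (r ℕ.+ s)
    lem = ℕSolver.solve-∀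

-- The left-hand sides of lem are values of objectiveOf, written out for the ring solver.
objective-exponent : ∀ b g r s .{{_ : NonZero (r ℕ.+ s)}} →
  objective (total b g r s) (ℕ.suc (dim b g r s)) (r ℕ.+ s) ≡ + exponent b g r s
-- Here k = b t, so floor and ceiling of k/t are both `b`.
objective-exponent b g ℕ.zero s@(ℕ.suc s-1) = trans
  (objective-split b g 0 s b b ceil floor)
  (trans (lem (+ b) (+ g) (+ s)) (sym (+exponent b g 0 s)))
  where
  floor : total b g 0 s ℕ./ s ≡ b ℕ.+ dim b g 0 s
  floor = trans (cong (ℕ._/ s) (total-mod b g 0 s)) (quotient-unique 0 (b ℕ.+ dim b g 0 s) s (ℕ.s≤s ℕ.z≤n))
  ceil : (total b g 0 s ℕ.+ s-1) ℕ./ s ≡ b ℕ.+ dim b g 0 s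
  ceil = trans (cong (ℕ._/ s) (trans (cong (ℕ._+ s-1) (total-mod b g 0 s)) (ℕ.+-comm _ s-1)))
    (quotient-unique s-1 (b ℕ.+ dim b g 0 s) s ℕ.≤-refl)
  lem : ∀ b g s → (b * (0ℤ + s) + 0ℤ) * (1ℤ + (b + g))
                    - b * b * ((b * (0ℤ + s) + 0ℤ) + (0ℤ + s) - b * (0ℤ + s))
                    - b * b * (b * (0ℤ + s) - (b * (0ℤ + s) + 0ℤ))
                  ≡ 0ℤ * g + (s * b + (0ℤ + s) * (b * g))
  lem = solve-∀
objective-exponent b g r@(ℕ.suc r-1) s = by-remainder s refl
  where
  t = r ℕ.+ s
  D = dim b g r s
  ceil : ⌈ total b g r s / t ⌉ ≡ ℕ.suc b ℕ.+ D
  -- As r ≥ 1, adding t - 1 carries: the quotient grows by one and the remainder becomes r - 1.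
  ceil = trans (cong (ℕ._/ t) (trans (cong (ℕ._+ (r-1 ℕ.+ s)) (total-mod b g r s)) (lem r-1 s (b ℕ.+ D))))
    (quotient-unique r-1 (ℕ.suc b ℕ.+ D) t (ℕ.s≤s (ℕ.m≤m+n r-1 s)))
    where
    lem : ∀ r s q → ℕ.suc r ℕ.+ q ℕ.* (ℕ.suc r ℕ.+ s) ℕ.+ (r ℕ.+ s) ≡ r ℕ.+ ℕ.suc q ℕ.* (ℕ.suc r ℕ.+ s)
    lem = ℕSolver.solve-∀
  by-remainder : ∀ s′ → s ≡ s′ → objective (total b g r s) (ℕ.suc D) t ≡ + exponent b g r s
  -- Now r = t, so k = (b + 1) t, and floor and ceiling of k/t are both `b + 1`.
  by-remainder ℕ.zero refl = trans
    (objective-split b g r 0 (ℕ.suc b) (ℕ.suc b) ceil floor)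
    (trans (lem (+ b) (+ g) (+ r)) (sym (+exponent b g r 0)))
    where
    lem : ∀ b g r → (b * (r + 0ℤ) + r) * (1ℤ + (b + g))
                      - (1ℤ + b) * (1ℤ + b) * ((b * (r + 0ℤ) + r) + (r + 0ℤ) - (1ℤ + b) * (r + 0ℤ))
                      - (1ℤ + b) * (1ℤ + b) * ((1ℤ + b) * (r + 0ℤ) - (b * (r + 0ℤ) + r))
                    ≡ r * g + (0ℤ * b + (r + 0ℤ) * (b * g))
    lem = solve-∀
    eq : ∀ r q → r ℕ.+ q ℕ.* (r ℕ.+ 0) ≡ ℕ.suc q ℕ.* (r ℕ.+ 0)
    eq = ℕSolver.solve-∀
    floor : total b g r 0 ℕ./ t ≡ ℕ.suc b ℕ.+ D
    floor = trans (cong (ℕ._/ t) (trans (total-mod b g r 0) (eq r (b ℕ.+ D))))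
      (quotient-unique 0 (ℕ.suc b ℕ.+ D) t (ℕ.s≤s ℕ.z≤n))
  -- Now 0 < r < t: the floor of k/t is `b` and the ceiling is `b + 1`.
  by-remainder (ℕ.suc s-1) refl = trans
    (objective-split b g r s (ℕ.suc b) b ceil floor)
    (trans (lem (+ b) (+ g) (+ r) (+ s)) (sym (+exponent b g r s)))
    where
    lem : ∀ b g r s → (b * (r + s) + r) * (1ℤ + (b + g))
                        - (1ℤ + b) * (1ℤ + b) * ((b * (r + s) + r) + (r + s) - (1ℤ + b) * (r + s))
                        - b * b * ((1ℤ + b) * (r + s) - (b * (r + s) + r))
                      ≡ r * g + (s * b + (r + s) * (b * g))
    lem = solve-∀
    floor : total b g r s ℕ./ t ≡ b ℕ.+ D
    floor = trans (cong (ℕ._/ t) (total-mod b g r s))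
      (quotient-unique r (b ℕ.+ D) t (ℕ.m<m+n r (ℕ.s≤s ℕ.z≤n)))

-- Specialisation to powers of p.

module PrimePowers (p b g r s : ℕ) .{{p≢0 : NonZero p}} where

  private instance
    p^r≢0 : NonZero (p ^ r)
    p^r≢0 = ℕ.m^n≢0 p r
    p^s≢0 : NonZero (p ^ s)
    p^s≢0 = ℕ.m^n≢0 p s

  open Family b g (p ^ r) (p ^ s)

  -- Wrapping the equation lets the exponent of a product be assembled by following the shape of the
  -- product.
  record Power (x m : ℕ) : Set where
    constructor power
    field equation : x ≡ p ^ m
  open Power

  +-power : ∀ {x y m n} → Power x m → Power y n → Power (x ℕ.* y) (m ℕ.+ n)
  +-power {m = m} {n} (power refl) (power refl) = power (sym (ℕ.^-distribˡ-+-* p m n))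

  *-power : ∀ {x m} n → Power x m → Power (x ^ n) (m ℕ.* n)
  *-power {m = m} n (power refl) = power (ℕ.^-*-assoc p m n)

  R-power : Power (p ^ r) r
  R-power = power refl

  S-power : Power (p ^ s) s
  S-power = power refl

  q-power : Power q (r ℕ.+ s)
  q-power = +-power R-power S-power

  index≡ : index ≡ p ^ total b g r s
  index≡ = trans
    (equation (+-power (+-power q-power R-power)
                       (+-power (*-power b (+-power q-power q-power)) (*-power g q-power))))
    (cong (p ^_) (lem b g r s))
    where
    lem : ∀ b g r s → r ℕ.+ s ℕ.+ r ℕ.+ ((r ℕ.+ s ℕ.+ (r ℕ.+ s)) ℕ.* b ℕ.+ (r ℕ.+ s) ℕ.* g)
                      ≡ (r ℕ.+ s) ℕ.* ℕ.suc (b ℕ.+ g) ℕ.+ (b ℕ.* (r ℕ.+ s) ℕ.+ r)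
    lem = ℕSolver.solve-∀

  count≡ : count ≡ p ^ exponent b g r s
  count≡ = equation
    (+-power (*-power g R-power) (+-power (*-power b S-power) (*-power (b ℕ.* g) q-power)))

  p^exponent≤f : p ^ exponent b g r s ≤ f (ℕ.suc d) (p ^ total b g r s)
  p^exponent≤f = subst₂ (λ N m → N ≤ f (ℕ.suc d) m) count≡ index≡ count≤f

-- The lower bound.

^ᶻ-≤ : ∀ p .{{_ : NonZero p}} {z k N} → z ≡ + k → p ^ k ≤ N → (+ N / 1) ≥ℚ (p ^ᶻ z)
^ᶻ-≤ p {N = N} refl le = ℚᵘ.*≤* (ℤ.*-monoʳ-≤-nonNeg 1ℤ (ℤ.+≤+ le))

-- With n = d + 2, the two bounds on `t` say 0 ≤ k ≤ t (n - 1), the range in which `divide` yields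
-- b, g, r and s.
p^objective≤f : ∀ p .{{_ : NonZero p}} d e t .{{_ : NonZero t}} →
  t ℕ.* ℕ.suc d ≤ e → e ≤ t ℕ.* ℕ.suc d ℕ.+ t ℕ.* ℕ.suc d →
  (+ f (ℕ.suc (ℕ.suc d)) (p ^ e) / 1) ≥ℚ (p ^ᶻ objective e (ℕ.suc (ℕ.suc d)) t)
p^objective≤f p d e t td≤e e≤2td
  with divide t d (e ∸ t ℕ.* ℕ.suc d) (ℕ.m≤n+o⇒m∸n≤o e (t ℕ.* ℕ.suc d) e≤2td)
... | division {b} {g} {r} {s} refl refl k≡
  -- Replaces `e` by `total b g r s`, so that the exponent identity and the count apply verbatim.
  with refl ← trans (sym (ℕ.m+[n∸m]≡n td≤e)) (cong (t ℕ.* ℕ.suc d ℕ.+_) k≡) =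
  ^ᶻ-≤ p (objective-exponent b g r s) (PrimePowers.p^exponent≤f p b g r s)

theorem1p8 : (n e : ℕ) (1<n : 1 < n) (n-1≤e : n ∸ 1 ≤ e)
    (p : ℕ) (p-prime : Prime p) →
    (+ f n (p ^ e) / 1) ≥ℚ (_^ᶻ_ p {{prime⇒nonZero p-prime}} (h e n 1<n n-1≤e))
theorem1p8 (ℕ.suc ℕ.zero) _ (ℕ.s≤s ())
theorem1p8 (ℕ.suc (ℕ.suc d)) e 1<n n-1≤e p p-prime
  -- The maximum is the value at some admissible `t`. Its upper limit gives t (n - 1) ≤ e and its
  -- lower limit gives e ≤ 2 t (n - 1).
  with t , t≢0 , lo≤t , t≤hi , h≡ ← maxOver-attained (objective e (ℕ.suc (ℕ.suc d)))
         (tMin e _ 1<n) (tMax e _ 1<n) {{tMax≢0 1<n n-1≤e}} (tMin≤tMax e _ 1<n n-1≤e) =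
  subst (λ z → _ ≥ℚ (p ^ᶻ z)) (sym h≡) (p^objective≤f p d e t {{t≢0}}
    (ℕ.≤-trans (ℕ.*-monoˡ-≤ (ℕ.suc d) t≤hi) (ℕ.m/n*n≤m e (ℕ.suc d)))
    (ℕ.≤-trans (⌈/⌉≤⇒≤* e (2 ℕ.* ℕ.suc d) t lo≤t) (ℕ.≤-reflexive (lem t (ℕ.suc d)))))
  where
  instance
    p≢0 : NonZero p
    p≢0 = prime⇒nonZero p-prime
  lem : ∀ t d → t ℕ.* (2 ℕ.* d) ≡ t ℕ.* d ℕ.+ t ℕ.* d
  lem = ℕSolver.solve-∀
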